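{- Let $k>1$ be an integer. If $2k-1$ has a (positive) divisor $d$ with $d\equiv \pm 3 \pmod{8}$, then the equation $x^2+(2k-1)^y=k^z$ has no solutions in positive integers $x,y,z$ with $y\in\{3,5\}$. -}

module Defs where

{-# OPTIONS --safe #-}
-- Modulo d the equation makes 2 a square when z is odd, which d ≡ ±3 (mod 8) forbids; so z = 2Z and
-- (k^Z − x)(k^Z + x) = (2k − 1)^y splits into coprime y-th powers a^y and b^y with ab + 1 = 2k and
-- a^y + b^y = 2k^Z.  Comparing sizes leaves only a = 1 or (y , Z) ∈ {(3 , 2) , (5 , 3) , (5 , 4)}.
-- Each exceptional pair is a curve with two rational places at infinity, and Runge's method applies: along
-- the branch a < b a nonvanishing integer polynomial in a and b tends to 0, which bounds a.
module Submission where

open import Defs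
open import Data.Empty using (⊥)
open import Data.Nat
open import Data.Nat.Coprimality as Coprime using (Coprime; coprime-divisor)
open import Data.Nat.DivMod
open import Data.Nat.Divisibility
open import Data.Nat.GCD
open import Data.Nat.Induction using (<-rec)
open import Data.Nat.Primality using (prime?; prime⇒irreducible)
open import Data.Nat.Properties
open import Data.Nat.Tactic.RingSolver using (solve-∀)
open import Data.Product using (∃; ∃₂; _×_; _,_)
open import Data.Sum using (_⊎_; inj₁; inj₂; [_,_]′)
open import Data.Unit using (tt)
open import Relation.Nullary using (¬_; ¬?; yes; no; contradiction)
open import Relation.Nullary.Decidable using (from-yes; from-no)
open import Relation.Binary.PropositionalEquality

-- For a ≥ 2 size confines Z to y/2 < Z < y: up to y/2 the single term b^y wins because 2k = 1 + ab
-- ≤ b², and from y on the power (1 + ab)^Z wins. Multiplying by 2^(Z - 1) removes k and leaves (1 +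
-- ab)^Z = 2^(Z - 1) (a^y + b^y); balancing (ab)^Z against 2^(Z - 1) b^y gives the branches a² ~ 2b,
-- a³ ~ 4b² and a⁴ ~ 8b. On the first and the last, b is asymptotically a polynomial in a, and one
-- remainder settles the matter. On a³ ~ 4b² the remainder E ~ 205a/b already tends to 0, but
-- asymptotically it drops below 1 only near a = 168000; two further steps lower this threshold
-- below 216 and leave a range that can be checked by evaluation. Everything stays in ℕ, so a
-- remainder must be shown nonnegative before it can be named.

-- Equations are combined with _⊕_ and _⊛_; a ring identity then rewrites the difference of the two
-- sides of the combination, either as a visibly positive number (exceeds⇒≢) or as that of x ≡ y (transfer).
exceeds⇒≢ : ∀ {x y t} → x ≡ y + suc t → y ≢ x
exceeds⇒≢ {y = y} e h = m+1+n≢m y (trans (sym e) (sym h))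

transfer : ∀ {p q} x y → p ≡ q → x + q ≡ y + p → x ≡ y
transfer {p} x y refl e = +-cancelʳ-≡ p x y e

infixl 6 _⊕_
_⊕_ : ∀ {p q r s : ℕ} → p ≡ q → r ≡ s → p + r ≡ q + s
_⊕_ = cong₂ _+_

infixr 6.5 _⊛_
_⊛_ : ∀ {p q : ℕ} x → p ≡ q → x * p ≡ x * q
x ⊛ e = cong (x *_) e

≤⇒offset : ∀ {m n} → m ≤ n → ∃ λ o → n ≡ m + o
≤⇒offset m≤n with o , refl ← m≤n⇒∃[o]m+o≡n m≤n = o , refl

-- Trades a refutation of x - y ≥ 0 for a witness of y - x; this is how the remainders `D`, `E`, `G`
-- and `H` come to exist in ℕ.
offset-unless : ∀ {x y} → (∀ r → x ≢ y + r) → ∃ λ r → y ≡ x + r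
offset-unless {x} {y} x≢y+ with ≤-total x y
... | inj₁ x≤y = ≤⇒offset x≤y
... | inj₂ y≤x with r , e ← ≤⇒offset y≤x = contradiction e (x≢y+ r)

obtain : ∀ {P : ℕ → Set} {C : Set} → ∃ P → (∀ x → P x → C) → C
obtain (x , px) k = k x px

even-or-odd : ∀ n → ∃ λ j → n ≡ 2 * j ⊎ n ≡ suc (2 * j)
even-or-odd zero = 0 , inj₁ refl
even-or-odd (suc n) with even-or-odd n
... | j , inj₁ refl = j , inj₂ refl
... | j , inj₂ refl = suc j , inj₁ (sym (*-suc 2 j))

^-distribʳ-* : ∀ n x y → (x * y) ^ n ≡ x ^ n * y ^ n
^-distribʳ-* zero    x y = refl
^-distribʳ-* (suc n) x y = trans (cong (x * y *_) (^-distribʳ-* n x y)) (interchange x y (x ^ n) (y ^ n))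
  where
  interchange : ∀ u v s t → u * v * (s * t) ≡ u * s * (v * t)
  interchange = solve-∀

x^3 : ∀ x → x ^ 3 ≡ x * x * x
x^3 x = trans (cong (λ y → x * (x * y)) (*-identityʳ x)) (sym (*-assoc x x x))

x^4 : ∀ x → x ^ 4 ≡ x * x * x * x
x^4 x = trans (*-comm x (x ^ 3)) (cong (_* x) (x^3 x))

x^5 : ∀ x → x ^ 5 ≡ x * x * x * x * x
x^5 x = trans (*-comm x (x ^ 4)) (cong (_* x) (x^4 x))

-- Quadratic character of 2

odd-square%8 : ∀ j → suc (2 * j) * suc (2 * j) % 8 ≡ 1
odd-square%8 j with even-or-odd j
... | i , inj₁ refl = trans (cong (_% 8) (expansion i)) ([m+kn]%n≡m%n 1 (i + 2 * (i * i)) 8)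
  where
  expansion : ∀ i → suc (2 * (2 * i)) * suc (2 * (2 * i)) ≡ 1 + (i + 2 * (i * i)) * 8
  expansion = solve-∀
... | i , inj₂ refl = trans (cong (_% 8) (expansion i)) ([m+kn]%n≡m%n 1 (1 + 3 * i + 2 * (i * i)) 8)
  where
  expansion : ∀ i → suc (2 * suc (2 * i)) * suc (2 * suc (2 * i)) ≡ 1 + (1 + 3 * i + 2 * (i * i)) * 8
  expansion = solve-∀

-- Every odd residue is its own inverse modulo 8, so d e ≡ -1 gives e ≡ -d, and the classes 3 and 5
-- are exchanged.
cofactor%8 : ∀ d e → (2 + d * e) % 8 ≡ 1 → d % 8 ≡ 3 ⊎ d % 8 ≡ 5 → e % 8 ≡ 3 ⊎ e % 8 ≡ 5
cofactor%8 d e h d± = residues d± (m%n<n e 8) (trans (sym mod-8) h)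
  where
  mod-8 : (2 + d * e) % 8 ≡ (2 + (d % 8) * (e % 8) % 8) % 8
  mod-8 = trans (%-distribˡ-+ 2 (d * e) 8) (cong (λ x → (2 + x) % 8) (%-distribˡ-* d e 8))
  residues : ∀ {δ ε} → δ ≡ 3 ⊎ δ ≡ 5 → ε < 8 → (2 + δ * ε % 8) % 8 ≡ 1 → ε ≡ 3 ⊎ ε ≡ 5
  residues {ε = 3} (inj₂ refl) _ _ = inj₁ refl
  residues {ε = 5} (inj₁ refl) _ _ = inj₂ refl
  residues {ε = 0} (inj₁ refl) _ ()
  residues {ε = 1} (inj₁ refl) _ ()
  residues {ε = 2} (inj₁ refl) _ ()
  residues {ε = 3} (inj₁ refl) _ ()
  residues {ε = 4} (inj₁ refl) _ ()
  residues {ε = 6} (inj₁ refl) _ ()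
  residues {ε = 7} (inj₁ refl) _ ()
  residues {ε = 0} (inj₂ refl) _ ()
  residues {ε = 1} (inj₂ refl) _ ()
  residues {ε = 2} (inj₂ refl) _ ()
  residues {ε = 4} (inj₂ refl) _ ()
  residues {ε = 5} (inj₂ refl) _ ()
  residues {ε = 6} (inj₂ refl) _ ()
  residues {ε = 7} (inj₂ refl) _ ()
  residues {ε = suc (suc (suc (suc (suc (suc (suc (suc _)))))))} _ (s≤s (s≤s (s≤s (s≤s (s≤s (s≤s (s≤s (s≤s ())))))))) _

3≤d : ∀ d → d % 8 ≡ 3 ⊎ d % 8 ≡ 5 → 3 ≤ d
3≤d d (inj₁ e) = subst (_≤ d) e (m%n≤m d 8)
3≤d d (inj₂ e) = ≤-trans (m≤m+n 3 2) (subst (_≤ d) e (m%n≤m d 8))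

odd : ∀ d → d % 8 ≡ 3 ⊎ d % 8 ≡ 5 → ∃ λ j → d ≡ suc (2 * j)
odd d (inj₁ e) = 1 + 4 * (d / 8) , trans (trans (m≡m%n+[m/n]*n d 8) (cong (_+ d / 8 * 8) e)) (regroup (d / 8))
  where
  regroup : ∀ q → 3 + q * 8 ≡ suc (2 * (1 + 4 * q))
  regroup = solve-∀
odd d (inj₂ e) = 2 + 4 * (d / 8) , trans (trans (m≡m%n+[m/n]*n d 8) (cong (_+ d / 8 * 8) e)) (regroup (d / 8))
  where
  regroup : ∀ q → 5 + q * 8 ≡ suc (2 * (2 + 4 * q))
  regroup = solve-∀

-- x² ≡ 2 (mod d), stated without subtraction, is refuted by descent: an odd r ≤ d with r² = 2 + d e
-- has d e ≡ −1 (mod 8), so the cofactor e < d is again ≡ ±3 (mod 8), and r² ≡ 2 (mod e).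
TwoNonresidue : ℕ → Set
TwoNonresidue d = d % 8 ≡ 3 ⊎ d % 8 ≡ 5 → ∀ x u v → x * x + d * u ≢ 2 + d * v

odd-representative : ∀ d → (∀ {e} → e < d → TwoNonresidue e) → d % 8 ≡ 3 ⊎ d % 8 ≡ 5 →
  ∀ j u v → let r = suc (2 * j) in r ≤ d → r * r + d * u ≢ 2 + d * v
odd-representative d descent d± j u v r≤d h with ≤-<-connex u v
-- Here r² = 2 - d (u - v) would be negative, as d ≥ 3.
... | inj₂ v<u with t , refl ← ≤⇒offset v<u = <⇒≱ (3≤d d d±) (+-cancelʳ-≤ (d * v) d 2 (begin
  d + d * v                          ≡⟨ *-suc d v ⟨
  d * suc v                          ≤⟨ *-monoʳ-≤ d (m≤m+n (suc v) t) ⟩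
  d * (suc v + t)                    ≤⟨ m≤n+m _ (suc (2 * j) * suc (2 * j)) ⟩
  suc (2 * j) * suc (2 * j) + d * (suc v + t) ≡⟨ h ⟩
  2 + d * v                          ∎))
  where open ≤-Reasoning
... | inj₁ u≤v with e , refl ← ≤⇒offset u≤v =
  descent e<d (cofactor%8 d e (trans (cong (_% 8) (sym r²≡2+de)) (odd-square%8 j)) d±) r 0 d
    (trans (cong (r * r +_) (*-zeroʳ e)) (trans (+-identityʳ (r * r)) (trans r²≡2+de (cong (2 +_) (*-comm d e)))))
  where
  r = suc (2 * j)
  regroup : ∀ d u e → 2 + d * (u + e) ≡ 2 + d * e + d * u
  regroup = solve-∀
  r²≡2+de : r * r ≡ 2 + d * e
  r²≡2+de = +-cancelʳ-≡ (d * u) (r * r) (2 + d * e) (trans h (regroup d u e))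
  e<d : e < d
  e<d = *-cancelˡ-< d e d (begin-strict
    d * e        <⟨ m<n+m (d * e) z<s ⟩
    2 + d * e    ≡⟨ r²≡2+de ⟨
    r * r        ≤⟨ *-mono-≤ r≤d r≤d ⟩
    d * d        ∎)
    where open ≤-Reasoning

2-nonresidue : ∀ d → TwoNonresidue d
2-nonresidue = <-rec TwoNonresidue step
  where
  step : ∀ d → (∀ {e} → e < d → TwoNonresidue e) → TwoNonresidue d
  step d descent d± x u v h = reduced (even-or-odd r) (odd d d±)
    where
    instance
      d≢0 : NonZero d
      d≢0 = >-nonZero (≤-trans (s≤s z≤n) (3≤d d d±))
    r = x % d
    q = x / d
    r≤d : r ≤ d
    r≤d = <⇒≤ (m%n<n x d)
    square : ∀ r q d u → r * r + d * (q * (2 * r + q * d) + u) ≡ (r + q * d) * (r + q * d) + d * u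
    square = solve-∀
    h′ : r * r + d * (q * (2 * r + q * d) + u) ≡ 2 + d * v
    h′ = trans (square r q d u) (trans (cong (λ y → y * y + d * u) (sym (m≡m%n+[m/n]*n x d))) h)
    reflected : ∀ r s u → s * s + (r + s) * (u + 2 * r) ≡ r * r + (r + s) * u + (r + s) * (r + s)
    reflected = solve-∀
    regroup : ∀ d v → 2 + d * v + d * d ≡ 2 + d * (v + d)
    regroup = solve-∀
    complement : ∀ s w → d ≡ r + s → r * r + d * w ≡ 2 + d * v → s * s + d * (w + 2 * r) ≡ 2 + d * (v + d)
    complement s w d≡ h = trans
      (subst (λ d → s * s + d * (w + 2 * r) ≡ r * r + d * w + d * d) (sym d≡) (reflected r s w))
      (trans (cong (_+ d * d) h) (regroup d v))
    reduced : (∃ λ j → r ≡ 2 * j ⊎ r ≡ suc (2 * j)) → (∃ λ i → d ≡ suc (2 * i)) → ⊥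
    reduced (j , inj₂ r≡) _ = odd-representative d descent d± j _ v (subst (_≤ d) r≡ r≤d)
      (trans (cong (λ y → y * y + d * (q * (2 * r + q * d) + u)) (sym r≡)) h′)
    -- An even residue r is replaced by d - r, which is odd because d is, and has the same square
    -- modulo d.
    reduced (j , inj₁ r≡) (i , d≡) with s , d≡r+s ← ≤⇒offset r≤d with even-or-odd s
    ... | l , inj₁ refl = even≢odd (j + l) i
      (trans (*-distribˡ-+ 2 j l) (trans (cong (_+ 2 * l) (sym r≡)) (trans (sym d≡r+s) d≡)))
    ... | l , inj₂ refl = odd-representative d descent d± l _ (v + d)
      (subst (suc (2 * l) ≤_) (sym d≡r+s) (m≤n+m _ r)) (complement (suc (2 * l)) _ d≡r+s h′)

-- Odd z

suc-power : ∀ c n → ∃ λ q → suc c ^ n ≡ 1 + c * q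
suc-power c zero = 0 , cong suc (sym (*-zeroʳ c))
suc-power c (suc n) with q , e ← suc-power c n = 1 + q + c * q , trans (cong (suc c *_) e) (regroup c q)
  where
  regroup : ∀ c q → suc c * (1 + c * q) ≡ 1 + c * (1 + q + c * q)
  regroup = solve-∀

-- Put z = 2n + 1 and multiply the equation by 2 · 2^z: x² becomes the square of 2^(n + 1) x, and
-- the right side becomes 2 (2k)^z = 2 (c + 1)^z, which is 2 modulo d since d divides c.
odd-exponent : ∀ {c k d} → suc c ≡ 2 * k → d ∣ c → d % 8 ≡ 3 ⊎ d % 8 ≡ 5 →
  ∀ x y n → x ^ 2 + c ^ suc y ≢ k ^ suc (2 * n)
odd-exponent {c} {k} {d} c+1≡2k (divides e c≡ed) d± x y n h
  with q , c+1^ ← suc-power c (suc (2 * n)) =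
  2-nonresidue d d± (2 * p * x) (4 * (p * p) * (e * c ^ y)) (2 * (e * q)) (begin
    2 * p * x * (2 * p * x) + d * (4 * (p * p) * (e * c ^ y))  ≡⟨ factor p x d e (c ^ y) ⟩
    2 * (2 * (p * p) * (x * (x * 1) + e * d * c ^ y))          ≡⟨ cong (λ c′ → 2 * (2 * (p * p) * (x ^ 2 + c′ * c ^ y))) c≡ed ⟨
    2 * (2 * (p * p) * (x ^ 2 + c ^ suc y))                    ≡⟨ cong₂ (λ u v → 2 * (2 * u * v)) p²≡ h ⟩
    2 * (2 ^ suc (2 * n) * k ^ suc (2 * n))                    ≡⟨ cong (2 *_) (^-distribʳ-* (suc (2 * n)) 2 k) ⟨
    2 * (2 * k) ^ suc (2 * n)                                  ≡⟨ cong (λ b → 2 * b ^ suc (2 * n)) c+1≡2k ⟨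
    2 * suc c ^ suc (2 * n)                                    ≡⟨ cong (2 *_) c+1^ ⟩
    2 * (1 + c * q)                                            ≡⟨ cong (λ c → 2 * (1 + c * q)) c≡ed ⟩
    2 * (1 + e * d * q)                                        ≡⟨ distribute d e q ⟩
    2 + d * (2 * (e * q))                                      ∎)
  where
  open ≡-Reasoning
  p = 2 ^ n
  p²≡ : p * p ≡ 2 ^ (2 * n)
  p²≡ = trans (sym (^-distribˡ-+-* 2 n n)) (cong (λ m → 2 ^ (n + m)) (sym (+-identityʳ n)))
  factor : ∀ p x d e u → 2 * p * x * (2 * p * x) + d * (4 * (p * p) * (e * u)) ≡
    2 * (2 * (p * p) * (x * (x * 1) + e * d * u))
  factor = solve-∀
  distribute : ∀ d e q → 2 * (1 + e * d * q) ≡ 2 + d * (2 * (e * q))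
  distribute = solve-∀

-- Splitting into coprime powers

coprime-* : ∀ {m n o} → Coprime m o → Coprime n o → Coprime (m * n) o
coprime-* m⊥o n⊥o (d∣mn , d∣o) =
  n⊥o (coprime-divisor (λ (e∣d , e∣m) → m⊥o (e∣m , ∣-trans e∣d d∣o)) d∣mn , d∣o)

coprime-^ : ∀ {m o} n → Coprime m o → Coprime (m ^ n) o
coprime-^ zero    _ (d∣1 , _) = ∣1⇒≡1 d∣1
coprime-^ (suc n) m⊥o = coprime-* m⊥o (coprime-^ n m⊥o)

-- The roots are g = gcd(m, c) and h = c / g, so no prime factorisation is involved. As g is coprime
-- to n, its power divides m; as m / g is coprime to h, it divides g^y, so m divides g^(y + 1).
coprime-factors-of-power : ∀ {m n c} y .{{_ : NonZero m}} → Coprime m n → m * n ≡ c ^ suc y →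
  ∃₂ λ a b → m ≡ a ^ suc y × n ≡ b ^ suc y × a * b ≡ c
coprime-factors-of-power {m} {n} {c} y m⊥n mn≡ = g , h , m≡ , n≡ , gh≡c
  where
  g = gcd m c
  g∣m = gcd[m,n]∣m m c
  g∣c = gcd[m,n]∣n m c
  h = quotient g∣c
  gh≡c : g * h ≡ c
  gh≡c = sym (m∣n⇒n≡m*quotient g∣c)
  m′ = quotient g∣m
  m≡gm′ : m ≡ g * m′
  m≡gm′ = m∣n⇒n≡m*quotient g∣m
  instance
    g≢0 : NonZero g
    g≢0 = ≢-nonZero (gcd[m,n]≢0 m c (inj₁ (≢-nonZero⁻¹ m)))
  mn≡g^h^ : m * n ≡ g ^ suc y * h ^ suc y
  mn≡g^h^ = trans mn≡ (trans (cong (_^ suc y) (sym gh≡c)) (^-distribʳ-* (suc y) g h))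
  m′⊥h : Coprime m′ h
  m′⊥h {d} (d∣m′ , d∣h) = ∣1⇒≡1 (*-cancelˡ-∣ g (subst (g * d ∣_) (sym (*-identityʳ g))
    (gcd-greatest (subst (g * d ∣_) (sym m≡gm′) (*-monoʳ-∣ g d∣m′)) (subst (g * d ∣_) gh≡c (*-monoʳ-∣ g d∣h)))))
  m′n≡ : m′ * n ≡ g ^ y * h ^ suc y
  m′n≡ = *-cancelˡ-≡ _ _ g (trans (sym (*-assoc g m′ n)) (trans (cong (_* n) (sym m≡gm′))
    (trans mn≡g^h^ (*-assoc g (g ^ y) (h ^ suc y)))))
  m∣g^ : m ∣ g ^ suc y
  m∣g^ = subst (_∣ g ^ suc y) (sym m≡gm′) (*-monoʳ-∣ g (coprime-divisor
    (Coprime.sym (coprime-^ (suc y) (Coprime.sym m′⊥h)))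
    (subst (m′ ∣_) (trans m′n≡ (*-comm (g ^ y) (h ^ suc y))) (m∣m*n n))))
  g^∣m : g ^ suc y ∣ m
  g^∣m = coprime-divisor (coprime-^ (suc y) (λ (d∣g , d∣n) → m⊥n (∣-trans d∣g g∣m , d∣n)))
    (subst (g ^ suc y ∣_) (trans (sym mn≡g^h^) (*-comm m n)) (m∣m*n (h ^ suc y)))
  m≡ : m ≡ g ^ suc y
  m≡ = ∣-antisym m∣g^ g^∣m
  n≡ : n ≡ h ^ suc y
  n≡ = *-cancelˡ-≡ _ _ m (trans mn≡g^h^ (cong (_* h ^ suc y) (sym m≡)))

coprime-suc : ∀ c → Coprime c (suc c)
coprime-suc c {d} (d∣c , d∣1+c) = ∣1⇒≡1 (∣m+n∣m⇒∣n (subst (d ∣_) (+-comm 1 c) d∣1+c) d∣c)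

2k^∣[2k]^ : ∀ k s → 2 * k ^ suc s ∣ (2 * k) ^ suc s
2k^∣[2k]^ k s = subst (2 * k ^ suc s ∣_) (sym (^-distribʳ-* (suc s) 2 k))
  (*-monoˡ-∣ (k ^ suc s) (m∣m*n {2} (2 ^ s)))

PowerPair : ℕ → ℕ → ℕ → ℕ → ℕ → Set
PowerPair k y Z a b = suc (a * b) ≡ 2 * k × a ^ y + b ^ y ≡ 2 * k ^ Z

-- The roots are returned as 1 + m and 2 + m + n: this encodes 0 < a < b in the form that makes
-- later polynomial differences visibly positive.
even-exponent : ∀ {c k} x y Z → suc c ≡ 2 * k → 0 < x → x ^ 2 + c ^ suc y ≡ k ^ (2 * suc Z) →
  ∃₂ λ m n → PowerPair k (suc y) (suc Z) (1 + m) (2 + m + n)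
even-exponent {c} {k} x y Z c+1≡2k 0<x h = from-offset (≤⇒offset x<w)
  where
  w = k ^ suc Z
  Pair = PowerPair k (suc y) (suc Z)
  instance
    c≢0 : NonZero c
    c≢0 = ≢-nonZero λ c≡0 → even≢odd k 0 (trans (sym c+1≡2k) (cong suc c≡0))
  x²+≡w² : x * x + c ^ suc y ≡ w * w
  x²+≡w² = begin
    x * x + c ^ suc y       ≡⟨ cong (λ u → x * u + c ^ suc y) (*-identityʳ x) ⟨
    x ^ 2 + c ^ suc y       ≡⟨ h ⟩
    k ^ (2 * suc Z)         ≡⟨ cong (λ u → k ^ (suc Z + u)) (+-identityʳ (suc Z)) ⟩
    k ^ (suc Z + suc Z)     ≡⟨ ^-distribˡ-+-* k (suc Z) (suc Z) ⟩
    w * w                   ∎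
    where open ≡-Reasoning
  x<w : x < w
  x<w = ≰⇒> λ w≤x → <⇒≱ (m<m+n (x * x) (m^n>0 c (suc y))) (≤-trans (≤-reflexive x²+≡w²) (*-mono-≤ w≤x w≤x))
  -- A common divisor divides the product, a power of c, and the sum 2k^Z, hence also (2k)^Z, a
  -- power of c + 1.
  coprime : ∀ {m n} → m * n ≡ c ^ suc y → m + n ≡ 2 * w → Coprime m n
  coprime {m} {n} mn≡ m+n≡ {d} (d∣m , d∣n) =
    coprime-^ (suc y) (Coprime.sym (coprime-^ (suc Z) (Coprime.sym (coprime-suc c))))
      ( subst (d ∣_) mn≡ (∣m⇒∣m*n n d∣m)
      , subst (λ b → d ∣ b ^ suc Z) (sym c+1≡2k)
          (∣-trans (subst (d ∣_) m+n≡ (∣m∣n⇒∣m+n d∣m d∣n)) (2k^∣[2k]^ k Z)) )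
  from-roots : ∀ {m n} → 0 < m → m < n → m + n ≡ 2 * w →
    (∃₂ λ a b → m ≡ a ^ suc y × n ≡ b ^ suc y × a * b ≡ c) → ∃₂ λ m n → Pair (1 + m) (2 + m + n)
  from-roots 0<m m<n m+n≡ (zero , b , refl , n≡ , ab≡c) = contradiction 0<m λ ()
  from-roots {m} 0<m m<n m+n≡ (suc a , b , m≡ , n≡ , ab≡c) = ordered (≤⇒offset a<b)
    where
    pair : Pair (suc a) b
    pair = trans (cong suc ab≡c) c+1≡2k , trans (sym (m≡ ⊕ n≡)) m+n≡
    a<b : suc a < b
    a<b = ≰⇒> λ b≤a → <⇒≱ m<n (subst₂ _≤_ (sym n≡) (sym m≡) (^-monoˡ-≤ (suc y) b≤a))
    ordered : (∃ λ r → b ≡ 2 + a + r) → ∃₂ λ m n → Pair (1 + m) (2 + m + n)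
    ordered (r , b≡) = a , r , subst (Pair (suc a)) b≡ pair
  -- The two factors are w - x = suc t and w + x = suc t + 2x.
  from-offset : (∃ λ t → w ≡ suc x + t) → ∃₂ λ m n → Pair (1 + m) (2 + m + n)
  from-offset (t , w≡) = from-roots z<s (m<m+n (suc t) (≤-trans 0<x (m≤n*m x 2))) m+n≡
    (coprime-factors-of-power y (coprime mn≡ m+n≡) mn≡)
    where
    square : ∀ x t → x * x + suc t * (suc t + 2 * x) ≡ (suc x + t) * (suc x + t)
    square = solve-∀
    total : ∀ x t → suc t + (suc t + 2 * x) ≡ 2 * (suc x + t)
    total = solve-∀
    mn≡ : suc t * (suc t + 2 * x) ≡ c ^ suc y
    mn≡ = +-cancelˡ-≡ (x * x) _ _ (trans (square x t) (trans (cong (λ u → u * u) (sym w≡)) (sym x²+≡w²)))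
    m+n≡ : suc t + (suc t + 2 * x) ≡ 2 * w
    m+n≡ = trans (total x t) (cong (2 *_) (sym w≡))

-- Exponents excluded by size

1+ab≤b² : ∀ {a b} → a < b → suc (a * b) ≤ b * b
1+ab≤b² {a} {suc b} a<b = begin
  suc (a * suc b)     ≤⟨ s≤s (m≤n+m (a * suc b) b) ⟩
  suc a * suc b       ≤⟨ *-monoˡ-≤ (suc b) a<b ⟩
  suc b * suc b       ∎
  where open ≤-Reasoning

-- From a < b follows 2k = 1 + ab ≤ b², so 2k^Z ≤ (2k)^(s + 1) ≤ b^(2 (s + 1)) ≤ b^y. Bounding Z by
-- `suc s` lets Z = 0 be treated with Z = 1.
small-exponent : ∀ {a b k} y Z s .{{_ : NonZero a}} .{{_ : NonZero k}} →
  a < b → suc (a * b) ≡ 2 * k →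
  Z ≤ suc s → 2 * suc s ≤ y → 2 * k ^ Z < a ^ y + b ^ y
small-exponent {a} {b@(suc _)} {k} y Z s a<b ab Z≤1+s 2s≤y = begin-strict
  2 * k ^ Z               ≤⟨ *-monoʳ-≤ 2 (^-monoʳ-≤ k Z≤1+s) ⟩
  2 * (k * k ^ s)         ≡⟨ *-assoc 2 k (k ^ s) ⟨
  2 * k * k ^ s           ≤⟨ *-monoʳ-≤ (2 * k) (^-monoˡ-≤ s (m≤n*m k 2)) ⟩
  (2 * k) ^ suc s         ≡⟨ cong (_^ suc s) ab ⟨
  suc (a * b) ^ suc s     ≤⟨ ^-monoˡ-≤ (suc s) (1+ab≤b² a<b) ⟩
  (b * b) ^ suc s         ≡⟨ cong (λ c → (b * c) ^ suc s) (*-identityʳ b) ⟨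
  (b ^ 2) ^ suc s         ≡⟨ ^-*-assoc b 2 (suc s) ⟩
  b ^ (2 * suc s)         ≤⟨ ^-monoʳ-≤ b 2s≤y ⟩
  b ^ y                   <⟨ m<n+m (b ^ y) (m^n>0 a y) ⟩
  a ^ y + b ^ y           ∎
  where open ≤-Reasoning

-- After multiplication by 2^y ≤ a^y the left side is at most 2 (ab)^y, while the right side is at
-- least 2 (1 + ab)^y. The use of 2 ≤ a is why a = 1 is treated apart.
large-exponent : ∀ {a b k} y Z .{{_ : NonZero y}} .{{_ : NonZero k}} → 2 ≤ a → a < b → suc (a * b) ≡ 2 * k →
  y ≤ Z → a ^ y + b ^ y < 2 * k ^ Z
large-exponent {a} {b} {k} y Z 2≤a a<b ab y≤Z = *-cancelˡ-< (2 ^ y) _ _ (begin-strict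
  2 ^ y * (a ^ y + b ^ y)   ≤⟨ *-monoʳ-≤ (2 ^ y) (+-monoˡ-≤ (b ^ y) (^-monoˡ-≤ y (<⇒≤ a<b))) ⟩
  2 ^ y * (b ^ y + b ^ y)   ≤⟨ *-monoˡ-≤ (b ^ y + b ^ y) (^-monoˡ-≤ y 2≤a) ⟩
  a ^ y * (b ^ y + b ^ y)   ≡⟨ doubled (a ^ y) (b ^ y) ⟩
  2 * (a ^ y * b ^ y)       ≡⟨ cong (2 *_) (^-distribʳ-* y a b) ⟨
  2 * (a * b) ^ y           <⟨ *-monoʳ-< 2 (^-monoˡ-< y (n<1+n (a * b))) ⟩
  2 * suc (a * b) ^ y       ≡⟨ cong (λ c → 2 * c ^ y) ab ⟩
  2 * (2 * k) ^ y           ≡⟨ cong (2 *_) (^-distribʳ-* y 2 k) ⟩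
  2 * (2 ^ y * k ^ y)       ≡⟨ swapped (2 ^ y) (k ^ y) ⟩
  2 ^ y * (2 * k ^ y)       ≤⟨ *-monoʳ-≤ (2 ^ y) (*-monoʳ-≤ 2 (^-monoʳ-≤ k y≤Z)) ⟩
  2 ^ y * (2 * k ^ Z)       ∎)
  where
  open ≤-Reasoning
  doubled : ∀ u v → u * (v + v) ≡ 2 * (u * v)
  doubled = solve-∀
  swapped : ∀ u v → 2 * (u * v) ≡ u * (2 * v)
  swapped = solve-∀

-- The cubic case

-- On the branch 2b ~ a² the integer c = a² − 2b would have to tend to 0; the cases c < 3 remain.

no-integer-quotient : ∀ a n → let b = 2 + n in suc (b * b) ≢ 2 * (a * b) + 2 * a
-- Division with remainder: 1 + b² = (b + 1)(b - 1) + 2 with 2 < b + 1, so both 2a ≤ b - 1 and 2a ≥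
-- b fail.
no-integer-quotient a n h with ≤-<-connex (2 * a) (suc n)
... | inj₁ 2a≤1+n with r , e ← ≤⇒offset 2a≤1+n =
  exceeds⇒≢ (certificate a n r) (sym h ⊕ (3 + n) ⊛ e)
  where
  certificate : ∀ a n r → let b = 2 + n in
    suc (b * b) + suc b * (2 * a + r) ≡ 2 * (a * b) + 2 * a + suc b * suc n + suc (1 + suc b * r)
  certificate = solve-∀
... | inj₂ 1+n<2a with r , e ← ≤⇒offset 1+n<2a =
  exceeds⇒≢ (certificate a n r) (h ⊕ (3 + n) ⊛ e)
  where
  certificate : ∀ a n r → let b = 2 + n in
    2 * (a * b) + 2 * a + suc b * (b + r) ≡ suc (b * b) + suc b * (2 * a) + suc (n + suc b * r)
  certificate = solve-∀

-- Substituting a² = 2b + c cancels the terms 2b³; what is left compares c b² with the smaller 2a (b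
-- + c).
quadratic-remainder : ∀ a b c → suc (a * b) * suc (a * b) ≡ 2 * (a * a * a + b * b * b) →
  a * a ≡ 2 * b + c → suc (c * (b * b)) ≡ 2 * (a * b) + 2 * (a * c)
quadratic-remainder a b c h e = transfer _ _
  (h ⊕ b * b ⊛ sym e ⊕ 2 * a ⊛ e)
  (certificate a b c)
  where
  certificate : ∀ a b c →
    suc (c * (b * b)) + (2 * (a * a * a + b * b * b) + b * b * (a * a) + 2 * a * (2 * b + c)) ≡
    2 * (a * b) + 2 * (a * c) + (suc (a * b) * suc (a * b) + b * b * (2 * b + c) + 2 * a * (a * a))
  certificate = solve-∀

square≢2sum : ∀ m n → let a = 1 + m ; b = 2 + m + n in
  suc (a * b) * suc (a * b) ≢ 2 * (a * a * a + b * b * b)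
square≢2sum m n h with ≤-<-connex (2 * (2 + m + n)) ((1 + m) * (1 + m))
... | inj₂ a²<2b with r , e ← ≤⇒offset a²<2b =
  exceeds⇒≢ (certificate m n r) (h ⊕ (2 + m + n) * (2 + m + n) ⊛ e)
  where
  certificate : ∀ m n r → let a = 1 + m ; b = 2 + m + n in
    2 * (a * a * a + b * b * b) + b * b * (suc (a * a) + r) ≡
    suc (a * b) * suc (a * b) + b * b * (2 * b)
      + suc (n * n + 2 * n + r * (b * b) + 2 * m + m * m + 2 * m * (a * a))
  certificate = solve-∀
... | inj₁ 2b≤a² with ≤⇒offset 2b≤a²
...   | c , e = remainder≢ c (quadratic-remainder (1 + m) (2 + m + n) c h e)
  where
  remainder≢ : ∀ c → let a = 1 + m ; b = 2 + m + n in suc (c * (b * b)) ≢ 2 * (a * b) + 2 * (a * c)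
  -- The cases c = 0 and c = 2 fail by parity, c = 1 by division by b + 1, and c ≥ 3 by size.
  remainder≢ 0 h = even≢odd ((1 + m) * (2 + m + n)) 0 (sym (trans h (even m n)))
    where
    even : ∀ m n → let a = 1 + m ; b = 2 + m + n in 2 * (a * b) + 2 * (a * 0) ≡ 2 * (a * b)
    even = solve-∀
  remainder≢ 1 h = no-integer-quotient (1 + m) (m + n) (trans (left m n) (trans h (right m n)))
    where
    left : ∀ m n → let b = 2 + m + n in suc (b * b) ≡ suc (1 * (b * b))
    left = solve-∀
    right : ∀ m n → let a = 1 + m ; b = 2 + m + n in 2 * (a * b) + 2 * (a * 1) ≡ 2 * (a * b) + 2 * a
    right = solve-∀
  remainder≢ 2 h = even≢odd ((1 + m) * (2 + m + n) + 2 * (1 + m))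
    ((2 + m + n) * (2 + m + n)) (sym (trans h (even m n)))
    where
    even : ∀ m n → let a = 1 + m ; b = 2 + m + n in 2 * (a * b) + 2 * (a * 2) ≡ 2 * (a * b + 2 * a)
    even = solve-∀
  remainder≢ (suc (suc (suc r))) h = exceeds⇒≢ (certificate m n r) (sym h)
    where
    certificate : ∀ m n r → let a = 1 + m ; b = 2 + m + n ; c = 3 + r in
      suc (c * (b * b)) ≡ 2 * (a * b) + 2 * (a * c)
        + suc (2 + 10 * n + m * m + 4 * m * n + 3 * n * n + r * (2 + 2 * m + m * m + 4 * n + 2 * m * n + n * n))
    certificate = solve-∀

doubled-power : ∀ {N c} k s → c ≡ 2 * k → N ≡ 2 * k ^ suc s → c ^ suc s ≡ 2 ^ s * N
doubled-power {N} {c} k s c≡2k N≡ = begin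
  c ^ suc s                     ≡⟨ cong (_^ suc s) c≡2k ⟩
  (2 * k) ^ suc s               ≡⟨ ^-distribʳ-* (suc s) 2 k ⟩
  2 * 2 ^ s * k ^ suc s         ≡⟨ regroup (2 ^ s) (k ^ suc s) ⟩
  2 ^ s * (2 * k ^ suc s)       ≡⟨ cong (2 ^ s *_) N≡ ⟨
  2 ^ s * N                     ∎
  where
  open ≡-Reasoning
  regroup : ∀ u v → 2 * u * v ≡ u * (2 * v)
  regroup = solve-∀

-- With 2k = b + 1, the number 1 + b³ lies strictly between 2k³ = (b + 1)³ / 4 and 2k⁴ = (b + 1)⁴ /
-- 8.
1+b³≢2k^ : ∀ n k .{{_ : NonZero k}} i → let b = 2 + n in suc b ≡ 2 * k → 1 + b ^ 3 ≢ 2 * k ^ (3 + i)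
1+b³≢2k^ n k zero c h = exceeds⇒≢ (certificate n)
  (subst₂ _≡_ (x^3 (3 + n)) (cong (λ x → 4 * (1 + x)) (x^3 (2 + n))) (doubled-power k 2 c h))
  where
  certificate : ∀ n → let b = 2 + n in
    4 * (1 + b * b * b) ≡ suc b * suc b * suc b + suc (8 + 21 * n + 15 * (n * n) + 3 * (n * n * n))
  certificate = solve-∀
1+b³≢2k^ n k (suc i) c h = <⇒≱ fourth-power-larger (begin
  suc b ^ 4                  ≡⟨ doubled-power {2 * k ^ 4} k 3 c refl ⟩
  8 * (2 * k ^ 4)            ≤⟨ *-monoʳ-≤ 8 (*-monoʳ-≤ 2 (^-monoʳ-≤ k (m≤m+n 4 i))) ⟩
  8 * (2 * k ^ (4 + i))      ≡⟨ cong (8 *_) h ⟨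
  8 * (1 + b ^ 3)            ∎)
  where
  open ≤-Reasoning
  b = 2 + n
  certificate : ∀ n → let b = 2 + n in
    suc b * suc b * suc b * suc b ≡
    suc (8 * (1 + b * b * b)) + (8 + 12 * n + 6 * (n * n) + 4 * (n * n * n) + n * n * n * n)
  certificate = solve-∀
  fourth-power-larger : 8 * (1 + b ^ 3) < suc b ^ 4
  fourth-power-larger = begin
    suc (8 * (1 + b ^ 3))    ≡⟨ cong (λ x → suc (8 * (1 + x))) (x^3 b) ⟩
    suc (8 * (1 + b * b * b)) ≤⟨ m≤m+n _ (8 + 12 * n + 6 * (n * n) + 4 * (n * n * n) + n * n * n * n) ⟩
    suc (8 * (1 + b * b * b)) + (8 + 12 * n + 6 * (n * n) + 4 * (n * n * n) + n * n * n * n)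
                             ≡⟨ certificate n ⟨
    suc b * suc b * suc b * suc b ≡⟨ x^4 (suc b) ⟨
    suc b ^ 4                ∎

no-cubic-solution : ∀ m n k .{{_ : NonZero k}} Z → let a = 1 + m ; b = 2 + m + n in
  suc (a * b) ≡ 2 * k → a ^ 3 + b ^ 3 ≢ 2 * k ^ Z
no-cubic-solution m n k 0 c h = <⇒≢ (small-exponent {1 + m} 3 0 0 (m≤m+n (2 + m) n) c z≤n (m≤m+n 2 1)) (sym h)
no-cubic-solution m n k 1 c h = <⇒≢ (small-exponent {1 + m} 3 1 0 (m≤m+n (2 + m) n) c ≤-refl (m≤m+n 2 1)) (sym h)
no-cubic-solution m n k 2 c h = square≢2sum m n (trans (sym (cong (suc (a * b) *_) (*-identityʳ (suc (a * b)))))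
  (trans (doubled-power k 1 c h) (cong (2 *_) (cong₂ _+_ (x^3 a) (x^3 b)))))
  where a = 1 + m ; b = 2 + m + n
no-cubic-solution zero n k (suc (suc (suc i))) c h = 1+b³≢2k^ n k i (trans (cong suc (sym (+-identityʳ (2 + n)))) c) h
no-cubic-solution (suc m) n k (suc (suc (suc i))) c h =
  <⇒≢ (large-exponent {2 + m} 3 (3 + i) (s≤s (s≤s z≤n)) (m≤m+n (3 + m) n) c (m≤m+n 3 i)) h

-- The quintic case with Z = 3

-- On the branch 4b² ~ a³ the expansion of the curve yields the successive integers D = a³ − 4b²,
-- E = bD − 13a², G = bE − 205a and H = bG − 5983.  Each turns out to be nonnegative, and b²H = O(√a)
-- with H ≠ 0 fails for a ≥ 216.

cube-gap : ∀ m n → let a = 1 + m ; b = 2 + m + n in ∃ λ g → b * b * b ≡ 4 * (a * a) + g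
cube-gap m n = _ , expansion m n
  where
  expansion : ∀ m n → let a = 1 + m ; b = 2 + m + n in b * b * b ≡ 4 * (a * a) +
    (4 + 4 * m + 12 * n + 2 * m * m + 12 * m * n + 6 * n * n + m * m * m + 3 * m * m * n + 3 * m * n * n + n * n * n)
  expansion = solve-∀

-- With this sign the curve reads -D (b³ - 4a²) = 13a²b² - 3ab - 1 > 0, although b³ ≥ 4a² by
-- `cube-gap`. The signs of `E` and `G` are settled in the same way.
4b²≢a³+ : ∀ m n g D → let a = suc m ; b = suc n in
  suc (a * b) * suc (a * b) * suc (a * b) ≡ 4 * (a * a * a * a * a + b * b * b * b * b) →
  b * b * b ≡ 4 * (a * a) + g → 4 * (b * b) ≢ a * a * a + D
4b²≢a³+ m n g D h gap e = exceeds⇒≢ (certificate m n g D)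
  (h ⊕ b * b * b ⊛ e ⊕ 4 * (a * a) ⊛ sym e ⊕ D ⊛ gap)
  where
  a = suc m ; b = suc n
  certificate : ∀ m n g D → let a = suc m ; b = suc n ; q = m + n + m * n in
    4 * (a * a * a * a * a + b * b * b * b * b) + b * b * b * (a * a * a + D)
      + 4 * (a * a) * (4 * (b * b)) + D * (4 * (a * a) + g) ≡
    suc (a * b) * suc (a * b) * suc (a * b) + b * b * b * (4 * (b * b))
      + 4 * (a * a) * (a * a * a + D) + D * (b * b * b)
      + suc (8 + 23 * q + 13 * (q * q) + D * g)
  certificate = solve-∀

-- That is, (b³ - 4a²) D = 13a²b² - 3ab - 1 with 13 = 4 · 4 - 3. Hence D ~ 13a²/b, which suggests
-- the next remainder bD - 13a².
D-equation : ∀ a b D →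
  suc (a * b) * suc (a * b) * suc (a * b) ≡ 4 * (a * a * a * a * a + b * b * b * b * b) →
  a * a * a ≡ 4 * (b * b) + D → suc (D * (b * b * b) + 3 * (a * b)) ≡ 4 * (a * a) * D + 13 * (a * a * (b * b))
D-equation a b D h f = transfer _ _
  (h ⊕ b * b * b ⊛ sym f ⊕ 4 * (a * a) ⊛ f)
  (certificate a b D)
  where
  certificate : ∀ a b D →
    suc (D * (b * b * b) + 3 * (a * b))
      + (4 * (a * a * a * a * a + b * b * b * b * b) + b * b * b * (a * a * a) + 4 * (a * a) * (4 * (b * b) + D)) ≡
    4 * (a * a) * D + 13 * (a * a * (b * b))
      + (suc (a * b) * suc (a * b) * suc (a * b) + b * b * b * (4 * (b * b) + D) + 4 * (a * a) * (a * a * a))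
  certificate = solve-∀

13a²≢bD+ : ∀ m n g D E → let a = suc m ; b = suc n in
  b * b * b ≡ 4 * (a * a) + g → a * a * a ≡ 4 * (b * b) + D →
  suc (D * (b * b * b) + 3 * (a * b)) ≡ 4 * (a * a) * D + 13 * (a * a * (b * b)) →
  13 * (a * a) ≢ b * D + E
13a²≢bD+ m n g D E gap f h e = exceeds⇒≢ (certificate m n g D E)
  (b ⊛ h ⊕ b * b * b ⊛ e ⊕ 4 * (a * a) ⊛ sym e ⊕ 52 * a ⊛ f ⊕ E ⊛ gap)
  where
  a = suc m ; b = suc n
  certificate : ∀ m n g D E → let a = suc m ; b = suc n in
    b * (4 * (a * a) * D + 13 * (a * a * (b * b))) + b * b * b * (b * D + E)
      + 4 * (a * a) * (13 * (a * a)) + 52 * a * (4 * (b * b) + D) + E * (4 * (a * a) + g) ≡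
    b * suc (D * (b * b * b) + 3 * (a * b)) + b * b * b * (13 * (a * a))
      + 4 * (a * a) * (b * D + E) + 52 * a * (a * a * a) + E * (b * b * b)
      + suc (203 * (b * b) + n * n + 2 * n + n * b + 205 * m * (b * b) + 52 * a * D + E * g)
  certificate = solve-∀

-- One step of the expansion: multiply by b, replace bD, and reduce the resulting 52a⁴ by a³ = 4b² +
-- D. Hence 52 = 4 · 13 and 205 = 4 · 52 - 3.
E-equation : ∀ a b D E → a * a * a ≡ 4 * (b * b) + D →
  suc (D * (b * b * b) + 3 * (a * b)) ≡ 4 * (a * a) * D + 13 * (a * a * (b * b)) →
  b * D ≡ 13 * (a * a) + E →
  b * b * b * E + b ≡ 205 * (a * (b * b)) + 52 * (a * D) + 4 * (a * a) * E
E-equation a b D E f h e = transfer _ _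
  (b ⊛ h ⊕ b * b * b ⊛ sym e ⊕ 4 * (a * a) ⊛ e ⊕ 52 * a ⊛ f)
  (certificate a b D E)
  where
  certificate : ∀ a b D E →
    b * b * b * E + b + (b * (4 * (a * a) * D + 13 * (a * a * (b * b))) + b * b * b * (b * D)
      + 4 * (a * a) * (13 * (a * a) + E) + 52 * a * (4 * (b * b) + D)) ≡
    205 * (a * (b * b)) + 52 * (a * D) + 4 * (a * a) * E
      + (b * suc (D * (b * b * b) + 3 * (a * b)) + b * b * b * (13 * (a * a) + E)
      + 4 * (a * a) * (b * D) + 52 * a * (a * a * a))
  certificate = solve-∀

205a≢bE+ : ∀ a n g D E G → let b = suc n in
  b * b * b ≡ 4 * (a * a) + g → a * a * a ≡ 4 * (b * b) + D → b * D ≡ 13 * (a * a) + E →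
  b * b * b * E + b ≡ 205 * (a * (b * b)) + 52 * (a * D) + 4 * (a * a) * E →
  205 * a ≢ b * E + G
205a≢bE+ a n g D E G gap f e h i = exceeds⇒≢ (certificate a n g D E G)
  (b ⊛ h ⊕ b * b * b ⊛ i ⊕ 52 * a ⊛ e ⊕ 4 * (a * a) ⊛ sym i ⊕ 1496 ⊛ f ⊕ G ⊛ gap)
  where
  b = suc n
  certificate : ∀ a n g D E G → let b = suc n in
    b * (205 * (a * (b * b)) + 52 * (a * D) + 4 * (a * a) * E) + b * b * b * (b * E + G)
      + 52 * a * (13 * (a * a) + E) + 4 * (a * a) * (205 * a) + 1496 * (4 * (b * b) + D) + G * (4 * (a * a) + g) ≡
    b * (b * b * b * E + b) + b * b * b * (205 * a)
      + 52 * a * (b * D) + 4 * (a * a) * (b * E + G) + 1496 * (a * a * a) + G * (b * b * b)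
      + suc (n * n + 2 * n + 5982 * (b * b) + 1496 * D + 52 * (a * E) + G * g)
  certificate = solve-∀

-- The same step again: 1496 = 13 · 52 + 4 · 205 collects the terms in a³, and 5983 = 4 · 1496 - 1.
G-equation : ∀ a b D E G → a * a * a ≡ 4 * (b * b) + D → b * D ≡ 13 * (a * a) + E →
  b * b * b * E + b ≡ 205 * (a * (b * b)) + 52 * (a * D) + 4 * (a * a) * E →
  b * E ≡ 205 * a + G →
  b * b * b * G ≡ 5983 * (b * b) + 1496 * D + 52 * (a * E) + 4 * (a * a) * G
G-equation a b D E G f e h i = transfer _ _
  (b ⊛ h ⊕ b * b * b ⊛ sym i ⊕ 52 * a ⊛ e ⊕ 4 * (a * a) ⊛ i ⊕ 1496 ⊛ f)
  (certificate a b D E G)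
  where
  certificate : ∀ a b D E G →
    b * b * b * G + (b * (205 * (a * (b * b)) + 52 * (a * D) + 4 * (a * a) * E) + b * b * b * (b * E)
      + 52 * a * (13 * (a * a) + E) + 4 * (a * a) * (205 * a + G) + 1496 * (4 * (b * b) + D)) ≡
    5983 * (b * b) + 1496 * D + 52 * (a * E) + 4 * (a * a) * G
      + (b * (b * b * b * E + b) + b * b * b * (205 * a + G)
      + 52 * a * (b * D) + 4 * (a * a) * (b * E) + 1496 * (a * a * a))
  certificate = solve-∀

-- In the next two lemmas κ = 5983, l = 1496, μ = 52 and ν = 205.

κ≢bG+ : ∀ m n κ l .{{_ : NonZero l}} D E G H → let a = suc m ; b = suc n in
  b * D ≡ 13 * (a * a) + E →
  b * b * b * G ≡ κ * (b * b) + l * D + 52 * (a * E) + 4 * (a * a) * G →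
  κ ≢ b * G + H
κ≢bG+ m n κ (suc l) D E G H e h i = exceeds⇒≢ (certificate κ l m n D E G H)
  (b ⊛ h ⊕ b * b * b ⊛ i ⊕ suc l ⊛ e)
  where
  a = suc m ; b = suc n
  certificate : ∀ κ l m n D E G H → let a = suc m ; b = suc n in
    b * (κ * (b * b) + suc l * D + 52 * (a * E) + 4 * (a * a) * G) + b * b * b * (b * G + H)
      + suc l * (13 * (a * a) + E) ≡
    b * (b * b * b * G) + b * b * b * κ + suc l * (b * D)
      + suc (12 + 13 * (m * m + 2 * m) + 13 * l * (a * a) + suc l * E + 52 * (a * b * E) + 4 * (a * a) * (b * G) + b * b * b * H)
  certificate = solve-∀

H-equation : ∀ a b κ l μ ν {α β γ} D E G H →
  α ≡ μ * ν + 13 * l + 4 * κ → β ≡ ν * l + μ * κ → γ ≡ l * κ →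
  b * D ≡ 13 * (a * a) + E → b * E ≡ ν * a + G →
  b * b * b * G ≡ κ * (b * b) + l * D + μ * (a * E) + 4 * (a * a) * G →
  b * G ≡ κ + H →
  b * b * (b * b * b) * H ≡
    (4 * (a * b * (a * b)) + μ * (a * b) + l) * H + (α * (a * b * (a * b)) + β * (a * b) + γ)
-- The additional factor b² allows E and G to be eliminated through bE and bG, so that only ab, b⁵
-- and H remain. Symbolic coefficients keep the large literals out of the ring identity.
H-equation a b κ l μ ν D E G H refl refl refl e i h j = transfer _ _
  (b * b * b ⊛ h ⊕ b * b * b * b * b ⊛ sym j ⊕ l * (b * b) ⊛ e ⊕ μ * (a * b * b) ⊛ i ⊕ 4 * (a * a) * (b * b) ⊛ j
    ⊕ l * b ⊛ i ⊕ μ * (a * b) ⊛ j ⊕ l ⊛ j)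
  (certificate a b κ l μ ν D E G H)
  where
  certificate : ∀ a b κ l μ ν D E G H →
    b * b * (b * b * b) * H
      + (b * b * b * (κ * (b * b) + l * D + μ * (a * E) + 4 * (a * a) * G) + b * b * b * b * b * (b * G)
      + l * (b * b) * (13 * (a * a) + E) + μ * (a * b * b) * (ν * a + G) + 4 * (a * a) * (b * b) * (κ + H)
      + l * b * (ν * a + G) + μ * (a * b) * (κ + H) + l * (κ + H)) ≡
    (4 * (a * b * (a * b)) + μ * (a * b) + l) * H
      + ((μ * ν + 13 * l + 4 * κ) * (a * b * (a * b)) + (ν * l + μ * κ) * (a * b) + l * κ)
      + (b * b * b * (b * b * b * G) + b * b * b * b * b * (κ + H)
      + l * (b * b) * (b * D) + μ * (a * b * b) * (b * E) + 4 * (a * a) * (b * b) * (b * G)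
      + l * b * (b * E) + μ * (a * b) * (b * G) + l * (b * G))
  certificate = solve-∀

-- Here 17 = 4 + 13: from b³ ≥ 17a² follows (b³ - 4a²) D ≥ 13a² D, whereas the equation makes it
-- less than 13a²b².
D≤b² : ∀ a b D → 17 ≤ a → a ≤ b →
  suc (D * (b * b * b) + 3 * (a * b)) ≡ 4 * (a * a) * D + 13 * (a * a * (b * b)) → D ≤ b * b
D≤b² a b D 17≤a a≤b h = ≮⇒≥ λ b²<D → contradictory (≤⇒offset 17a²≤b³) (≤⇒offset b²<D)
  where
  17a²≤b³ : 17 * (a * a) ≤ b * b * b
  17a²≤b³ = begin
    17 * (a * a)  ≤⟨ *-monoˡ-≤ (a * a) 17≤a ⟩
    a * (a * a)   ≡⟨ *-assoc a a a ⟨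
    a * a * a     ≤⟨ *-mono-≤ (*-mono-≤ a≤b a≤b) a≤b ⟩
    b * b * b     ∎
    where open ≤-Reasoning
  contradictory : (∃ λ u → b * b * b ≡ 17 * (a * a) + u) → ¬ ∃ λ t → D ≡ suc (b * b) + t
  contradictory (u , gap) (t , refl) = exceeds⇒≢ (certificate a b u t) (sym h ⊕ D ⊛ gap)
    where
    certificate : ∀ a b u t → let D = suc (b * b) + t in
      suc (D * (b * b * b) + 3 * (a * b)) + D * (17 * (a * a) + u) ≡
      4 * (a * a) * D + 13 * (a * a * (b * b)) + D * (b * b * b)
        + suc (13 * (a * a) * suc t + D * u + 3 * (a * b))
    certificate = solve-∀

-- Otherwise a³ < 5 · 36a² = 180a².
6a≤b : ∀ a b → 216 ≤ a → a * a * a ≤ 5 * (b * b) → 6 * a ≤ b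
6a≤b a@(suc _) b 216≤a a³≤5b² = ≮⇒≥ λ b<6a → <-irrefl refl (begin-strict
  a * a * a                ≤⟨ a³≤5b² ⟩
  5 * (b * b)              <⟨ *-monoʳ-< 5 (*-mono-< b<6a b<6a) ⟩
  5 * (6 * a * (6 * a))    ≡⟨ collect a ⟩
  180 * (a * a)            ≤⟨ *-monoˡ-≤ (a * a) (≤-trans (m≤m+n 180 36) 216≤a) ⟩
  a * (a * a)              ≡⟨ *-assoc a a a ⟨
  a * a * a                ∎)
  where
  open ≤-Reasoning
  collect : ∀ a → 5 * (6 * a * (6 * a)) ≡ 180 * (a * a)
  collect = solve-∀

-- P = ab and Q = b⁵; the bound on P is 6 · 216².
H-equation-unsolvable : ∀ P Q → 279936 ≤ P → P * P * P ≤ 5 * Q →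
  ∀ H → Q * H ≢ (4 * (P * P) + 52 * P + 1496) * H + (54040 * (P * P) + 617796 * P + 8950568)
H-equation-unsolvable P Q P-large P³≤5Q zero h = <⇒≢ positive (trans (sym (*-zeroʳ Q)) h)
  where
  positive : 0 < (4 * (P * P) + 52 * P + 1496) * 0 + (54040 * (P * P) + 617796 * P + 8950568)
  positive = ≤-trans z<s (≤-trans (m≤n+m 8950568 (54040 * (P * P) + 617796 * P))
    (m≤n+m (54040 * (P * P) + 617796 * P + 8950568) ((4 * (P * P) + 52 * P + 1496) * 0)))
-- As H ≥ 1, the equation gives Q ≤ 54049 P², and P³ ≤ 5Q then gives P ≤ 270245, just below 279936.
-- This fixes the threshold 216.
H-equation-unsolvable P@(suc _) Q P-large P³≤5Q H@(suc _) h = <-irrefl refl (begin-strict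
  279936 * S     ≤⟨ *-monoˡ-≤ S P-large ⟩
  P * S          ≡⟨ *-assoc P P P ⟨
  P * P * P      ≤⟨ P³≤5Q ⟩
  5 * Q          ≤⟨ *-monoʳ-≤ 5 Q≤54049S ⟩
  5 * (54049 * S) ≡⟨ *-assoc 5 54049 S ⟨
  270245 * S     <⟨ *-monoˡ-< S (<ᵇ⇒< 270245 279936 tt) ⟩
  279936 * S     ∎)
  where
  open ≤-Reasoning
  S = P * P
  linear≤S : ∀ {c} → c ≤ P → c * P ≤ S
  linear≤S c≤P = *-monoˡ-≤ P c≤P
  H-coefficient : 4 * S + 52 * P + 1496 ≤ 5 * S
  H-coefficient = begin
    4 * S + 52 * P + 1496     ≤⟨ +-monoʳ-≤ (4 * S + 52 * P) (≤-trans (≤ᵇ⇒≤ 1496 279936 tt) P-large) ⟩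
    4 * S + 52 * P + P        ≡⟨ collect S P ⟩
    4 * S + 53 * P            ≤⟨ +-monoʳ-≤ (4 * S) (linear≤S (≤-trans (≤ᵇ⇒≤ 53 279936 tt) P-large)) ⟩
    4 * S + S                 ≡⟨ +-comm (4 * S) S ⟩
    5 * S                     ∎
    where
    collect : ∀ S P → 4 * S + 52 * P + P ≡ 4 * S + 53 * P
    collect = solve-∀
  constant-term : 54040 * S + 617796 * P + 8950568 ≤ 54044 * S
  constant-term = begin
    54040 * S + 617796 * P + 8950568
      ≤⟨ +-mono-≤ (+-monoʳ-≤ (54040 * S) (*-monoˡ-≤ P (≤ᵇ⇒≤ 617796 839808 tt))) (≤ᵇ⇒≤ 8950568 (32 * 279936) tt) ⟩
    54040 * S + 3 * 279936 * P + 32 * 279936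
      ≡⟨ cong (λ x → 54040 * S + x + 32 * 279936) (*-assoc 3 279936 P) ⟩
    54040 * S + 3 * (279936 * P) + 32 * 279936
      ≤⟨ +-mono-≤ (+-monoʳ-≤ (54040 * S) (*-monoʳ-≤ 3 (linear≤S P-large))) (*-monoʳ-≤ 32 P-large) ⟩
    54040 * S + 3 * S + 32 * P
      ≤⟨ +-monoʳ-≤ (54040 * S + 3 * S) (linear≤S (≤-trans (≤ᵇ⇒≤ 32 279936 tt) P-large)) ⟩
    54040 * S + 3 * S + S
      ≡⟨ collect 54040 S ⟩
    (54040 + 4) * S ∎
    where
    collect : ∀ α S → α * S + 3 * S + S ≡ (α + 4) * S
    collect = solve-∀
  Q≤54049S : Q ≤ 54049 * S
  Q≤54049S = *-cancelʳ-≤ Q (54049 * S) H (begin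
    Q * H                                  ≡⟨ h ⟩
    (4 * S + 52 * P + 1496) * H + (54040 * S + 617796 * P + 8950568)
      ≤⟨ +-mono-≤ (*-monoˡ-≤ H H-coefficient) constant-term ⟩
    5 * S * H + 54044 * S                  ≤⟨ +-monoʳ-≤ (5 * S * H) (m≤m*n (54044 * S) H) ⟩
    5 * S * H + 54044 * S * H              ≡⟨ collect 54044 S H ⟩
    (5 + 54044) * S * H                    ∎)
    where
    collect : ∀ α S H → 5 * S * H + α * S * H ≡ (5 + α) * S * H
    collect = solve-∀

216≰a : ∀ a b D H → 216 ≤ a → a ≤ b → a * a * a ≡ 4 * (b * b) + D →
  suc (D * (b * b * b) + 3 * (a * b)) ≡ 4 * (a * a) * D + 13 * (a * a * (b * b)) →
  b * b * (b * b * b) * H ≢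
    (4 * (a * b * (a * b)) + 52 * (a * b) + 1496) * H + (54040 * (a * b * (a * b)) + 617796 * (a * b) + 8950568)
216≰a a b D H 216≤a a≤b f hD = H-equation-unsolvable (a * b) (b * b * (b * b * b)) 279936≤ab P³≤5Q H
  where
  open ≤-Reasoning
  a³≤5b² : a * a * a ≤ 5 * (b * b)
  a³≤5b² = begin
    a * a * a            ≡⟨ f ⟩
    4 * (b * b) + D      ≤⟨ +-monoʳ-≤ (4 * (b * b)) (D≤b² a b D (≤-trans (m≤m+n 17 199) 216≤a) a≤b hD) ⟩
    4 * (b * b) + b * b  ≡⟨ +-comm (4 * (b * b)) (b * b) ⟩
    5 * (b * b)          ∎
  279936≤ab : 279936 ≤ a * b
  279936≤ab = begin
    216 * (6 * 216)      ≤⟨ *-mono-≤ 216≤a (*-monoʳ-≤ 6 216≤a) ⟩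
    a * (6 * a)          ≤⟨ *-monoʳ-≤ a (6a≤b a b 216≤a a³≤5b²) ⟩
    a * b                ∎
  P³≤5Q : a * b * (a * b) * (a * b) ≤ 5 * (b * b * (b * b * b))
  P³≤5Q = begin
    a * b * (a * b) * (a * b)        ≡⟨ regroup a b ⟩
    a * a * a * (b * b * b)          ≤⟨ *-monoˡ-≤ (b * b * b) a³≤5b² ⟩
    5 * (b * b) * (b * b * b)        ≡⟨ *-assoc 5 (b * b) (b * b * b) ⟩
    5 * (b * b * (b * b * b))        ∎
    where
    regroup : ∀ a b → a * b * (a * b) * (a * b) ≡ a * a * a * (b * b * b)
    regroup = solve-∀

b<1588 : ∀ a b D → a ≤ 215 → a * a * a ≡ 4 * (b * b) + D → b < 1588
b<1588 a b D a≤215 f = ≰⇒> λ 1588≤b → <-irrefl refl (begin-strict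
  4 * (b * b)        ≤⟨ m≤m+n (4 * (b * b)) D ⟩
  4 * (b * b) + D    ≡⟨ f ⟨
  a * a * a          ≤⟨ *-mono-≤ (*-mono-≤ a≤215 a≤215) a≤215 ⟩
  215 * 215 * 215    <⟨ <ᵇ⇒< (215 * 215 * 215) (4 * (1588 * 1588)) tt ⟩
  4 * (1588 * 1588)  ≤⟨ *-monoʳ-≤ 4 (*-mono-≤ 1588≤b 1588≤b) ⟩
  4 * (b * b)        ∎)
  where open ≤-Reasoning

abstract
  -- Decided by evaluation for a ≤ 215; `b<1588` yields n < 1586 because b = 2 + m + n. `abstract`
  -- blocks unfolding of the computed proof.
  cube≢4sum-small : ∀ {m} → m < 215 → ∀ {n} → n < 1586 → let a = 1 + m ; b = 2 + m + n in
    suc (a * b) * suc (a * b) * suc (a * b) ≢ 4 * (a * a * a * a * a + b * b * b * b * b)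
  cube≢4sum-small = from-yes (allUpTo? (λ m → allUpTo? (λ n → let a = 1 + m ; b = 2 + m + n in
    ¬? (suc (a * b) * suc (a * b) * suc (a * b) ≟ 4 * (a * a * a * a * a + b * b * b * b * b))) 1586) 215)

cube≢4sum : ∀ m n → let a = 1 + m ; b = 2 + m + n in
  suc (a * b) * suc (a * b) * suc (a * b) ≢ 4 * (a * a * a * a * a + b * b * b * b * b)
cube≢4sum m n h =
  obtain (cube-gap m n) λ g gap →
  obtain (offset-unless (λ D → 4b²≢a³+ m (1 + m + n) g D h gap)) λ D f →
  let hD = D-equation a b D h f in
  obtain (offset-unless (λ E → 13a²≢bD+ m (1 + m + n) g D E gap f hD)) λ E e →
  let hE = E-equation a b D E f hD e in
  obtain (offset-unless (λ G → 205a≢bE+ a (1 + m + n) g D E G gap f e hE)) λ G i →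
  let hG = G-equation a b D E G f e hE i in
  obtain (offset-unless (λ H → κ≢bG+ m (1 + m + n) 5983 1496 D E G H e hG)) λ H j →
  [ (λ 216≤a → 216≰a a b D H 216≤a (m≤n⇒m≤1+n (m≤m+n a n)) f hD
      (H-equation a b 5983 1496 52 205 {54040} {617796} {8950568} D E G H refl refl refl e i hG j))
  , (λ a<216 → cube≢4sum-small (≤-pred a<216) (+-cancelˡ-< (2 + m) n 1586
      (≤-trans (b<1588 a b D (≤-pred a<216) f) (+-monoˡ-≤ 1586 (m≤m+n 2 m)))) h)
  ]′ (≤-<-connex 216 a)
  where
  a = 1 + m ; b = 2 + m + n

-- The quintic case with Z ≠ 3

-- With P = ab, the term P⁴ = a⁴b⁴ of (1 + P)⁴ exceeds 8b⁵ when a⁴ > 8b, and 4P³ exceeds 8a⁵ because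
-- b³ > 2a².
a⁴≢1+8b+ : ∀ m n r → let a = 3 + m ; b = 4 + m + n in
  suc (a * b) * suc (a * b) * suc (a * b) * suc (a * b) ≡ 8 * (a * a * a * a * a + b * b * b * b * b) →
  a * a * a * a ≢ suc (8 * (b + r))
a⁴≢1+8b+ m n r h e = exceeds⇒≢ (certificate m n r) (sym h ⊕ b * b * b * b ⊛ e)
  where
  b = 4 + m + n
  certificate : ∀ m n r → let a = 3 + m ; b = 4 + m + n in
    suc (a * b) * suc (a * b) * suc (a * b) * suc (a * b) + b * b * b * b * suc (8 * (b + r)) ≡
    8 * (a * a * a * a * a + b * b * b * b * b) + b * b * b * b * (a * a * a * a)
      + suc ((8 * r + 1) * (b * b * b * b) + 6 * (a * b * (a * b)) + 4 * (a * b) + 4 * (a * a * a) *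
        (46 + 36 * m + 48 * n + 10 * m * m + 24 * m * n + 12 * n * n + m * m * m + 3 * m * m * n + 3 * m * n * n + n * n * n))
  certificate = solve-∀

quintic-remainder : ∀ a b c →
  suc (a * b) * suc (a * b) * suc (a * b) * suc (a * b) ≡ 8 * (a * a * a * a * a + b * b * b * b * b) →
  8 * b ≡ a * a * a * a + c → let P = a * b in
  c * (b * b * b * b) + 8 * (a * a * a * a * a) ≡ 4 * (P * P * P) + 6 * (P * P) + 4 * P + 1
quintic-remainder a b c h e = transfer _ _
  (sym h ⊕ b * b * b * b ⊛ sym e)
  (certificate a b c)
  where
  certificate : ∀ a b c → let P = a * b in
    c * (b * b * b * b) + 8 * (a * a * a * a * a) + (suc P * suc P * suc P * suc P + b * b * b * b * (8 * b)) ≡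
    4 * (P * P * P) + 6 * (P * P) + 4 * P + 1
      + (8 * (a * a * a * a * a + b * b * b * b * b) + b * b * b * b * (a * a * a * a + c))
  certificate = solve-∀

-- The remainder equation bounds c b⁴ by 4P³ plus lower terms; with a⁴ ≤ 8b this makes c a at most
-- about 32. The value 35 leaves 3P³ to absorb the lower terms 88P², which P ≥ 30 allows.
8b≢a⁴+ : ∀ a b c .{{_ : NonZero a}} .{{_ : NonZero b}} → 35 ≤ c * a → 30 ≤ a * b →
  suc (a * b) * suc (a * b) * suc (a * b) * suc (a * b) ≡ 8 * (a * a * a * a * a + b * b * b * b * b) →
  8 * b ≢ a * a * a * a + c
8b≢a⁴+ a@(suc _) b@(suc _) c 35≤ca 30≤P h e = <-irrefl refl (begin-strict
  32 * (P * P * P) + 3 * P * (P * P)            ≡⟨ regroup a b ⟩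
  35 * (a * a * a * (b * b * b))                ≤⟨ *-monoˡ-≤ (a * a * a * (b * b * b)) 35≤ca ⟩
  c * a * (a * a * a * (b * b * b))             ≡⟨ regroup′ a b c ⟩
  c * (a * a * a * a) * (b * b * b)             ≤⟨ *-monoˡ-≤ (b * b * b) (*-monoʳ-≤ c a⁴≤8b) ⟩
  c * (8 * b) * (b * b * b)                     ≡⟨ regroup″ b c ⟩
  8 * (c * (b * b * b * b))                     ≤⟨ *-monoʳ-≤ 8 cb⁴≤ ⟩
  8 * (4 * (P * P * P) + 6 * (P * P) + 4 * P + 1)
    ≤⟨ *-monoʳ-≤ 8 (+-mono-≤ (+-monoʳ-≤ (4 * (P * P * P) + 6 * (P * P)) (*-monoʳ-≤ 4 (m≤m*n P P))) (s≤s z≤n)) ⟩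
  8 * (4 * (P * P * P) + 6 * (P * P) + 4 * (P * P) + P * P)
                                                ≡⟨ collect P ⟩
  32 * (P * P * P) + 88 * (P * P)               <⟨ +-monoʳ-< (32 * (P * P * P)) (*-monoˡ-< (P * P) 88<3P) ⟩
  32 * (P * P * P) + 3 * P * (P * P)            ∎)
  where
  open ≤-Reasoning
  P = a * b
  a⁴≤8b : a * a * a * a ≤ 8 * b
  a⁴≤8b = ≤-trans (m≤m+n (a * a * a * a) c) (≤-reflexive (sym e))
  cb⁴≤ : c * (b * b * b * b) ≤ 4 * (P * P * P) + 6 * (P * P) + 4 * P + 1
  cb⁴≤ = ≤-trans (m≤m+n _ (8 * (a * a * a * a * a))) (≤-reflexive (quintic-remainder a b c h e))
  88<3P : 88 < 3 * P
  88<3P = ≤-trans (m≤m+n 89 1) (*-monoʳ-≤ 3 30≤P)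
  regroup : ∀ a b → 32 * (a * b * (a * b) * (a * b)) + 3 * (a * b) * (a * b * (a * b)) ≡ 35 * (a * a * a * (b * b * b))
  regroup = solve-∀
  regroup′ : ∀ a b c → c * a * (a * a * a * (b * b * b)) ≡ c * (a * a * a * a) * (b * b * b)
  regroup′ = solve-∀
  regroup″ : ∀ b c → c * (8 * b) * (b * b * b) ≡ 8 * (c * (b * b * b * b))
  regroup″ = solve-∀
  collect : ∀ P → 8 * (4 * (P * P * P) + 6 * (P * P) + 4 * (P * P) + P * P) ≡ 32 * (P * P * P) + 88 * (P * P)
  collect = solve-∀

fourth-power≢8sum : ∀ j n → let a = 3 + 2 * j ; b = 4 + 2 * j + n in
  suc (a * b) * suc (a * b) * suc (a * b) * suc (a * b) ≢ 8 * (a * a * a * a * a + b * b * b * b * b)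
fourth-power≢8sum j n h =
  [ (λ b≤q → at-most-q (≤⇒offset b≤q)) , (λ q<b → above-q j h (≤⇒offset q<b)) ]′ (≤-<-connex (4 + 2 * j + n) (q j))
  where
  -- This is (a⁴ - 1) / 8 for the odd number a = 2i + 1.
  q : ℕ → ℕ
  q j = let i = 1 + j in 2 * (i * i * i * i) + 4 * (i * i * i) + 3 * (i * i) + i
  -- Hence 8b > a⁴ already forces 8b ≥ a⁴ + 7.
  a⁴≡8q+1 : ∀ j → let a = 3 + 2 * j ; i = 1 + j in
    a * a * a * a ≡ suc (8 * (2 * (i * i * i * i) + 4 * (i * i * i) + 3 * (i * i) + i))
  a⁴≡8q+1 = solve-∀
  at-most-q : ¬ ∃ λ r → q j ≡ 4 + 2 * j + n + r
  at-most-q (r , e) = a⁴≢1+8b+ (2 * j) n r h (trans (a⁴≡8q+1 j) (cong (λ x → suc (8 * x)) e))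
  shift : ∀ q r → 8 * (suc q + r) ≡ suc (8 * q) + (7 + 8 * r)
  shift = solve-∀
  shift₃ : ∀ r → 8 * (11 + suc r) ≡ 81 + (15 + 8 * r)
  shift₃ = solve-∀
  above-q : ∀ j → let a = 3 + 2 * j ; b = 4 + 2 * j + n in
    suc (a * b) * suc (a * b) * suc (a * b) * suc (a * b) ≡ 8 * (a * a * a * a * a + b * b * b * b * b) →
    ¬ ∃ λ r → b ≡ suc (q j) + r
  -- For a = 3 the bound c ≥ 7 gives only c a ≥ 21, so b = 11 is evaluated, and every larger b has c
  -- ≥ 15. From a = 5 on, 7 · 5 = 35 suffices.
  above-q zero h (zero , refl) = contradiction h λ ()
  above-q zero h (suc r , e) = 8b≢a⁴+ 3 (4 + n) (15 + 8 * r)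
    (≤-trans (m≤m+n 35 10) (*-monoˡ-≤ 3 (m≤m+n 15 (8 * r))))
    (*-monoʳ-≤ 3 (≤-trans (m≤m+n 10 (2 + r)) (≤-reflexive (sym e)))) h (trans (cong (8 *_) e) (shift₃ r))
  above-q (suc j) h (r , e) = 8b≢a⁴+ (3 + 2 * suc j) (4 + 2 * suc j + n) (7 + 8 * r)
    (*-mono-≤ (m≤m+n 7 (8 * r)) (+-monoʳ-≤ 3 2≤2+2j))
    (*-mono-≤ (+-monoʳ-≤ 3 2≤2+2j) (≤-trans (+-monoʳ-≤ 4 2≤2+2j) (m≤m+n _ n))) h
    (trans (cong (8 *_) e) (trans (shift (q (suc j)) r) (cong (_+ (7 + 8 * r)) (sym (a⁴≡8q+1 (suc j))))))
    where
    2≤2+2j : 2 ≤ 2 * suc j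
    2≤2+2j = *-monoʳ-≤ 2 (s≤s z≤n)

-- (1 + (2k − 1)⁵) / 2k = 16k⁴ − 40k³ + 40k² − 20k + 5, with the negative terms moved to the left.
power-quotient : ∀ j i → let k = 2 + j ; b = 3 + 2 * j in 1 + b ^ 5 ≡ 2 * k ^ (2 + i) →
  k ^ suc i + k * (40 * (k * k) + 20) ≡ k * (16 * (k * k * k) + 40 * k) + 5
power-quotient j i h = *-cancelˡ-≡ _ _ (2 * k) (begin
  2 * k * (k ^ suc i + k * (40 * (k * k) + 20))               ≡⟨ left k (k ^ suc i) ⟩
  2 * (k * k ^ suc i) + 2 * k * (k * (40 * (k * k) + 20))     ≡⟨ cong (_+ 2 * k * (k * (40 * (k * k) + 20)))
                                                                   (trans (sym h) (cong suc (x^5 (3 + 2 * j)))) ⟩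
  1 + (3 + 2 * j) * (3 + 2 * j) * (3 + 2 * j) * (3 + 2 * j) * (3 + 2 * j) + 2 * k * (k * (40 * (k * k) + 20))
                                                              ≡⟨ right j ⟩
  2 * k * (k * (16 * (k * k * k) + 40 * k) + 5)               ∎)
  where
  open ≡-Reasoning
  k = 2 + j
  left : ∀ k u → 2 * k * (u + k * (40 * (k * k) + 20)) ≡ 2 * (k * u) + 2 * k * (k * (40 * (k * k) + 20))
  left = solve-∀
  right : ∀ j → let k = 2 + j ; b = 3 + 2 * j in
    1 + b * b * b * b * b + 2 * k * (k * (40 * (k * k) + 20)) ≡ 2 * k * (k * (16 * (k * k * k) + 40 * k) + 5)
  right = solve-∀

-- The value 59050 = 1 + 9⁵ belongs to k = 5; it is a multiple of 50 but not of 250.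
59050≢2*5^ : ∀ i → 59050 ≢ 2 * 5 ^ (2 + i)
59050≢2*5^ zero h = contradiction h λ ()
59050≢2*5^ (suc i) h = from-no (250 ∣? 59050) (divides (5 ^ i) (trans h (collect (5 ^ i))))
  where
  collect : ∀ u → 2 * (5 * (5 * (5 * u))) ≡ u * 250
  collect = solve-∀

-- In `power-quotient` every term other than the final 5 is a multiple of k, so k divides 5, and k ≥
-- 2 leaves only k = 5.
1+b⁵≢2k^ : ∀ j i → let k = 2 + j ; b = 3 + 2 * j in 1 + b ^ 5 ≢ 2 * k ^ (2 + i)
1+b⁵≢2k^ j i h =
  [ (λ ())
  , (λ k≡5 → 59050≢2*5^ i (subst (λ j → 1 + (3 + 2 * j) ^ 5 ≡ 2 * (2 + j) ^ (2 + i)) (+-cancelˡ-≡ 2 j 3 k≡5) h))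
  ]′ (prime⇒irreducible (from-yes (prime? 5)) k∣5)
  where
  k = 2 + j
  k∣5 : k ∣ 5
  k∣5 = ∣m+n∣m⇒∣n (subst (k ∣_) (power-quotient j i h) (∣m∣n⇒∣m+n (m∣m*n (k ^ i)) (m∣m*n (40 * (k * k) + 20))))
    (m∣m*n (16 * (k * k * k) + 40 * k))

quintic-a≡1 : ∀ n k i → suc (1 * (2 + n)) ≡ 2 * k → 1 + (2 + n) ^ 5 ≢ 2 * k ^ (2 + i)
quintic-a≡1 n (suc zero) i ()
quintic-a≡1 n (suc (suc j)) i c h = 1+b⁵≢2k^ j i (trans (cong (λ b → 1 + b ^ 5) (sym b≡3+2j)) h)
  where
  regroup : ∀ j → 2 * (2 + j) ≡ 4 + 2 * j
  regroup = solve-∀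
  b≡3+2j : 2 + n ≡ 3 + 2 * j
  b≡3+2j = suc-injective (trans (cong suc (sym (+-identityʳ (2 + n)))) (trans c (regroup j)))

-- As 1 + ab is even, a is odd; this is what makes a⁴ ≡ 1 (mod 8) available.
quintic-exponent-4 : ∀ m n k → let a = 2 + m ; b = 3 + m + n in suc (a * b) ≡ 2 * k → a ^ 5 + b ^ 5 ≢ 2 * k ^ 4
quintic-exponent-4 m n k c h with even-or-odd m
... | j , inj₁ refl = even≢odd k ((1 + j) * (3 + 2 * j + n)) (trans (sym c) (cong suc (regroup j n)))
  where
  regroup : ∀ j n → (2 + 2 * j) * (3 + 2 * j + n) ≡ 2 * ((1 + j) * (3 + 2 * j + n))
  regroup = solve-∀
... | j , inj₂ refl = fourth-power≢8sum j n
  (trans (sym (x^4 (suc (a * b)))) (trans (doubled-power k 3 c h) (cong (8 *_) (cong₂ _+_ (x^5 a) (x^5 b)))))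
  where a = 3 + 2 * j ; b = 4 + 2 * j + n

no-quintic-solution : ∀ m n k .{{_ : NonZero k}} Z → let a = 1 + m ; b = 2 + m + n in
  suc (a * b) ≡ 2 * k → a ^ 5 + b ^ 5 ≢ 2 * k ^ Z
no-quintic-solution m n k Z c h with Z ≤? 2
... | yes Z≤2 = <⇒≢ (small-exponent {1 + m} 5 Z 1 (m≤m+n (2 + m) n) c Z≤2 (m≤m+n 4 1)) (sym h)
no-quintic-solution m n k 0 c h | no Z≰2 = Z≰2 z≤n
no-quintic-solution m n k 1 c h | no Z≰2 = Z≰2 (s≤s z≤n)
no-quintic-solution m n k 2 c h | no Z≰2 = Z≰2 ≤-refl
no-quintic-solution m n k 3 c h | no _ = cube≢4sum m n
  (trans (sym (x^3 (suc (a * b)))) (trans (doubled-power k 2 c h) (cong (4 *_) (cong₂ _+_ (x^5 a) (x^5 b)))))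
  where a = 1 + m ; b = 2 + m + n
no-quintic-solution zero n k (suc (suc (suc (suc i)))) c h | no _ = quintic-a≡1 n k (2 + i) c h
no-quintic-solution (suc m) n k 4 c h | no _ = quintic-exponent-4 m n k c h
no-quintic-solution (suc m) n k (suc (suc (suc (suc (suc i))))) c h | no _ =
  <⇒≢ (large-exponent {2 + m} 5 (5 + i) (s≤s (s≤s z≤n)) (m≤m+n (3 + m) n) c (m≤m+n 5 i)) h

no-cubic-pair : ∀ k .{{_ : NonZero k}} Z → ¬ ∃₂ λ m n → PowerPair k 3 Z (1 + m) (2 + m + n)
no-cubic-pair k Z (m , n , c , h) = no-cubic-solution m n k Z c h

no-quintic-pair : ∀ k .{{_ : NonZero k}} Z → ¬ ∃₂ λ m n → PowerPair k 5 Z (1 + m) (2 + m + n)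
no-quintic-pair k Z (m , n , c , h) = no-quintic-solution m n k Z c h

theorem1p1 : (k : ℕ) → 1 < k → (d : ℕ) → d ∣ (2 * k ∸ 1) → (d % 8 ≡ 3 ⊎ d % 8 ≡ 5) →
    (x y z : ℕ) → 0 < x → 0 < y → 0 < z → (y ≡ 3 ⊎ y ≡ 5) →
    x ^ 2 + (2 * k ∸ 1) ^ y ≢ k ^ z
theorem1p1 k@(suc _) 1<k d d∣c d± x y z 0<x 0<y 0<z y∈ h with even-or-odd z
theorem1p1 k@(suc _) 1<k d d∣c d± x (suc y) z 0<x 0<y 0<z y∈ h | n , inj₂ refl =
  -- Since k is a successor, 2k ∸ 1 computes, and `refl` proves that its successor is 2k.
  odd-exponent {k = k} refl d∣c d± x y n h
theorem1p1 k@(suc _) 1<k d d∣c d± x .3 z 0<x 0<y 0<z (inj₁ refl) h | suc Z , inj₁ refl =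
  no-cubic-pair k (suc Z) (even-exponent x 2 Z refl 0<x h)
theorem1p1 k@(suc _) 1<k d d∣c d± x .5 z 0<x 0<y 0<z (inj₂ refl) h | suc Z , inj₁ refl =
  no-quintic-pair k (suc Z) (even-exponent x 4 Z refl 0<x h)
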